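{- Fix a positive integer $k$ and a real number $\epsilon > 0$. Then all but finitely many numerical semigroups $\Lambda$ with $e(\Lambda) = k$ satisfy $c(\Lambda) > 0$ and \[ \frac{c'(\Lambda)}{c(\Lambda)} > \frac{1}{k} - \epsilon. \]
   Context: A numerical semigroup is a subset $\Lambda \subseteq \mathbb{Z}_{\ge 0}$ that contains $0$, is closed under addition, and has finite complement in $\mathbb{Z}_{\ge 0}$. Every numerical semigroup has a unique minimal (with respect to inclusion) generating set, which is finite; its size is the embedding dimension $e(\Lambda)$. The conductor is $c(\Lambda) = \max(\mathbb{Z}_{\ge 0}\setminus\Lambda) + 1$ (with $c(\Lambda)=0$ if $\Lambda = \mathbb{Z}_{\ge 0}$). Define $c'(\Lambda) = |\{\lambda \in \Lambda : \lambda < c(\Lambda)\}|$. -}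

module Defs where

open import Data.List.Base using (List; filter; length; map; upTo)
open import Data.List.Extrema.Nat using (max)
open import Data.List.Membership.Propositional using (_∈_)
open import Data.List.Relation.Unary.Unique.Propositional using (Unique)
open import Data.Nat.Base as ℕ using (ℕ; _≥_)
import Data.Nat.Properties as ℕ
open import Data.Product using (Σ-syntax; ∃-syntax; _×_; _,_; proj₁)
open import Data.Rational.Base as ℚ using (ℚ; 0ℚ; ½; ∣_∣)
import Data.Rational.Properties as ℚ
open import Data.Rational.Solver using (module +-*-Solver)
open import Level using (0ℓ)
open import Relation.Binary.PropositionalEquality using (_≡_; refl; cong; subst; sym)
open import Relation.Nullary.Decidable using (¬?)
open import Relation.Unary using (Pred; Decidable; _⊆_; _≐_; ∁)

-- Real numbers are Cauchy sequences of rationals. Two sequences may represent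
-- the same real; the order below respects this.

record ℝ : Set where
  field
    seq    : ℕ → ℚ
    cauchy : ∀ δ → 0ℚ ℚ.< δ →
             ∃[ N ] (∀ m n → m ≥ N → n ≥ N → ∣ seq m ℚ.- seq n ∣ ℚ.< δ)

open ℝ public

infix  4 _<ℝ_
infixl 6 _-ℝ_

-- The positive gap δ is needed: a termwise strict inequality passes to the
-- limit only as ≤.

_<ℝ_ : ℝ → ℝ → Set
x <ℝ y = Σ[ δ ∈ ℚ ] (0ℚ ℚ.< δ) ×
         (∃[ N ] (∀ n → n ≥ N → seq x n ℚ.+ δ ℚ.≤ seq y n))

fromℚ : ℚ → ℝ
fromℚ q .seq _ = q
fromℚ q .cauchy δ 0<δ = 0 , λ _ _ _ _ →
  subst (ℚ._< δ) (sym (cong ∣_∣ (ℚ.+-inverseʳ q))) 0<δ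

0ℝ : ℝ
0ℝ = fromℚ 0ℚ

private
  half>0 : ∀ {δ} → 0ℚ ℚ.< δ → 0ℚ ℚ.< ½ ℚ.* δ
  half>0 {δ} 0<δ = subst (ℚ._< ½ ℚ.* δ) (ℚ.*-zeroʳ ½) (ℚ.*-monoʳ-<-pos ½ 0<δ)

  half+half : ∀ δ → ½ ℚ.* δ ℚ.+ ½ ℚ.* δ ≡ δ
  half+half = solve 1 (λ δ → con ½ :* δ :+ con ½ :* δ := δ) refl
    where open +-*-Solver

  regroup : ∀ a b c d → (a ℚ.- b) ℚ.- (c ℚ.- d) ≡ (a ℚ.- c) ℚ.- (b ℚ.- d)
  regroup = solve 4 (λ a b c d →
      (a :+ (:- b)) :+ (:- (c :+ (:- d))) := (a :+ (:- c)) :+ (:- (b :+ (:- d)))) refl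
    where open +-*-Solver

_-ℝ_ : ℝ → ℝ → ℝ
(x -ℝ y) .seq n = seq x n ℚ.- seq y n
(x -ℝ y) .cauchy δ 0<δ
  with M , x-close ← cauchy x (½ ℚ.* δ) (half>0 0<δ)
  with N , y-close ← cauchy y (½ ℚ.* δ) (half>0 0<δ)
  = M ℕ.⊔ N , close
  where
  open ℚ.≤-Reasoning
  close : ∀ m n → m ≥ M ℕ.⊔ N → n ≥ M ℕ.⊔ N →
          ∣ (seq x m ℚ.- seq y m) ℚ.- (seq x n ℚ.- seq y n) ∣ ℚ.< δ
  close m n m≥ n≥ = begin-strict
    ∣ (seq x m ℚ.- seq y m) ℚ.- (seq x n ℚ.- seq y n) ∣
      ≡⟨ cong ∣_∣ (regroup (seq x m) (seq y m) (seq x n) (seq y n)) ⟩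
    ∣ (seq x m ℚ.- seq x n) ℚ.- (seq y m ℚ.- seq y n) ∣
      ≤⟨ ℚ.∣p-q∣≤∣p∣+∣q∣ (seq x m ℚ.- seq x n) (seq y m ℚ.- seq y n) ⟩
    ∣ seq x m ℚ.- seq x n ∣ ℚ.+ ∣ seq y m ℚ.- seq y n ∣
      <⟨ ℚ.+-mono-< (x-close m n (ℕ.m⊔n≤o⇒m≤o M N m≥) (ℕ.m⊔n≤o⇒m≤o M N n≥))
                    (y-close m n (ℕ.m⊔n≤o⇒n≤o M N m≥) (ℕ.m⊔n≤o⇒n≤o M N n≥)) ⟩
    ½ ℚ.* δ ℚ.+ ½ ℚ.* δ
      ≡⟨ half+half δ ⟩
    δ ∎

-- Decidability of membership, automatic classically, is what makes the gaps
-- and the conductor computable. The list witnessing `cofinite` may contain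
-- repetitions and elements of the semigroup.

record NumericalSemigroup : Set₁ where
  field
    carrier  : Pred ℕ 0ℓ
    carrier? : Decidable carrier
    0∈       : carrier 0
    +-closed : ∀ {m n} → carrier m → carrier n → carrier (m ℕ.+ n)
    cofinite : Σ[ xs ∈ List ℕ ] (∁ carrier ⊆ (_∈ xs))

open NumericalSemigroup public

infix 4 _≈_

_≈_ : NumericalSemigroup → NumericalSemigroup → Set
Λ ≈ Λ′ = carrier Λ ≐ carrier Λ′

gaps : NumericalSemigroup → List ℕ
gaps Λ = filter (λ n → ¬? (carrier? Λ n)) (proj₁ (cofinite Λ))

-- The default value 0 is returned exactly when there are no gaps.

conductor : NumericalSemigroup → ℕ
conductor Λ = max 0 (map ℕ.suc (gaps Λ))

c′ : NumericalSemigroup → ℕ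
c′ Λ = length (filter (carrier? Λ) (upTo (conductor Λ)))

data ⟨_⟩ (G : Pred ℕ 0ℓ) : Pred ℕ 0ℓ where
  gen  : ∀ {n} → G n → ⟨ G ⟩ n
  zero : ⟨ G ⟩ 0
  add  : ∀ {m n} → ⟨ G ⟩ m → ⟨ G ⟩ n → ⟨ G ⟩ (m ℕ.+ n)

_Generates_ : Pred ℕ 0ℓ → NumericalSemigroup → Set
G Generates Λ = ⟨ G ⟩ ≐ carrier Λ

_MinimallyGenerates_ : Pred ℕ 0ℓ → NumericalSemigroup → Set₁
G MinimallyGenerates Λ =
  G Generates Λ × (∀ (H : Pred ℕ 0ℓ) → H Generates Λ → H ⊆ G → G ⊆ H)

-- A relation rather than a function; it determines k because the minimal
-- generating set is unique.

HasEmbeddingDimension : NumericalSemigroup → ℕ → Set₁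
HasEmbeddingDimension Λ k =
  Σ[ gs ∈ List ℕ ] Unique gs × length gs ≡ k × (_∈ gs) MinimallyGenerates Λ

{-# OPTIONS --safe #-}
module Submission where

-- Let m be the least positive generator, c the conductor and N = m + c. The
-- Apéry set of m has exactly m elements w, all below N, and counting Λ below c
-- along residue classes gives m c′ ≈ Σ (c − w). For a generator h ≠ m, the total
-- multiplicity of h in the w's is at most the number of pairs (w, j), j ≥ 1, with
-- w + j h < N, because w − h is again an Apéry element when it lies in Λ. Hence
-- that generator contributes at most Σ (N − w) to Σ w, so that
-- Σ w ≤ (k − 1) Σ (N − w), and c ≤ k (c′ + m) follows. If c ≥ T m the error m is
-- at most c / T. If c < T m, the Apéry elements are combinations of the generators
-- with coefficients at most T, so m, and then c, is bounded in terms of k and T,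
-- which leaves finitely many semigroups.

open import Defs
open import Data.List.Base using (List; []; _∷_; _++_; _∷ʳ_; filter; length; map; upTo)
open import Data.List.Extrema.Nat using (xs≤max)
open import Data.List.Membership.Propositional using (_∈_; lose)
open import Data.List.Membership.Propositional.Properties
  using (∈-filter⁺; ∈-filter⁻; ∈-upTo⁺; ∈-map⁺; ∈-++⁺ˡ; ∈-++⁺ʳ)
open import Data.List.Properties using (length-++; filter-++; upTo-∷ʳ)
open import Data.List.Relation.Unary.All as All using (All; []; _∷_; all?)
open import Data.List.Relation.Unary.Any using (Any; here; there)
import Data.List.Relation.Unary.Any.Properties as Any
open import Data.Nat.Base hiding (_/_)
open import Data.Nat.ListAction using (sum)
open import Data.Nat.Properties
open import Data.Nat.Tactic.RingSolver using (solve-∀)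
open import Data.Product using (Σ-syntax; ∃-syntax; _×_; _,_; proj₁; proj₂)
open import Data.Sum.Base as Sum using (_⊎_; inj₁; inj₂)
open import Function.Base using (_∘_; const; case_of_)
open import Level using (0ℓ)
open import Relation.Binary.PropositionalEquality
open import Relation.Nullary.Decidable using (Dec; yes; no; ¬?; _⊎-dec_)
open import Relation.Nullary.Negation using (¬_; contradiction)
open import Relation.Unary using (Pred; Decidable)

open import Data.List.Membership.DecPropositional _≟_ using (_∈?_)

-- Finite sums over initial segments of the naturals.

∑ : ℕ → (ℕ → ℕ) → ℕ
∑ zero    f = 0
∑ (suc n) f = f 0 + ∑ n (f ∘ suc)

-- Translation by t with extension by 0. Writing f (n ∸ t) instead would give the value f 0 to all n
-- < t.
shift : ℕ → (ℕ → ℕ) → ℕ → ℕ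
shift zero    f n       = f n
shift (suc t) f zero    = 0
shift (suc t) f (suc n) = shift t f n

∑-mono : ∀ n {f g} → (∀ i → i < n → f i ≤ g i) → ∑ n f ≤ ∑ n g
∑-mono zero    f≤g = z≤n
∑-mono (suc n) f≤g = +-mono-≤ (f≤g 0 z<s) (∑-mono n λ i i<n → f≤g (suc i) (s<s i<n))

∑-cong : ∀ n {f g} → (∀ i → f i ≡ g i) → ∑ n f ≡ ∑ n g
∑-cong zero    f≡g = refl
∑-cong (suc n) f≡g = cong₂ _+_ (f≡g 0) (∑-cong n (f≡g ∘ suc))

∑-const : ∀ n x → ∑ n (const x) ≡ n * x
∑-const zero    x = refl
∑-const (suc n) x = cong (x +_) (∑-const n x)

∑-zero : ∀ n → ∑ n (const 0) ≡ 0
∑-zero n = trans (∑-const n 0) (*-zeroʳ n)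

+-interchange : ∀ a b c d → (a + b) + (c + d) ≡ (a + c) + (b + d)
+-interchange = solve-∀

∑-distrib-+ : ∀ n f g → ∑ n (λ i → f i + g i) ≡ ∑ n f + ∑ n g
∑-distrib-+ zero    f g = refl
∑-distrib-+ (suc n) f g = trans
  (cong (f 0 + g 0 +_) (∑-distrib-+ n (f ∘ suc) (g ∘ suc)))
  (+-interchange (f 0) (g 0) _ _)

∑-*ʳ : ∀ n f x → ∑ n (λ i → f i * x) ≡ ∑ n f * x
∑-*ʳ zero    f x = refl
∑-*ʳ (suc n) f x = trans (cong (f 0 * x +_) (∑-*ʳ n (f ∘ suc) x))
                         (sym (*-distribʳ-+ x (f 0) _))

∑-*ˡ : ∀ n f x → ∑ n (λ i → x * f i) ≡ x * ∑ n f
∑-*ˡ zero    f x = sym (*-zeroʳ x)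
∑-*ˡ (suc n) f x = trans (cong (x * f 0 +_) (∑-*ˡ n (f ∘ suc) x))
                         (sym (*-distribˡ-+ x (f 0) _))

∑-comm : ∀ m n (f : ℕ → ℕ → ℕ) → ∑ m (λ i → ∑ n (f i)) ≡ ∑ n (λ j → ∑ m (λ i → f i j))
∑-comm zero    n f = sym (∑-zero n)
∑-comm (suc m) n f = trans (cong (∑ n (f 0) +_) (∑-comm m n (f ∘ suc)))
                           (sym (∑-distrib-+ n (f 0) _))

∑-+ : ∀ m n f → ∑ (m + n) f ≡ ∑ m f + ∑ n (λ i → f (m + i))
∑-+ zero    n f = refl
∑-+ (suc m) n f = trans (cong (f 0 +_) (∑-+ m n (f ∘ suc))) (sym (+-assoc (f 0) _ _))

∑-suc : ∀ n f → ∑ (suc n) f ≡ ∑ n f + f n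
∑-suc zero    f = +-identityʳ (f 0)
∑-suc (suc n) f = trans (cong (f 0 +_) (∑-suc n (f ∘ suc))) (sym (+-assoc (f 0) _ _))

∑-monoˡ : ∀ {m n} f → m ≤ n → ∑ m f ≤ ∑ n f
∑-monoˡ f z≤n       = z≤n
∑-monoˡ f (s≤s m≤n) = +-monoʳ-≤ (f 0) (∑-monoˡ (f ∘ suc) m≤n)

term≤∑ : ∀ {n i} f → i < n → f i ≤ ∑ n f
term≤∑ {suc n} {zero}  f i<n       = m≤m+n (f 0) _
term≤∑ {suc n} {suc i} f (s<s i<n) = ≤-trans (term≤∑ (f ∘ suc) i<n) (m≤n+m _ (f 0))

∑-shift : ∀ t n f → ∑ n (shift t f) ≡ ∑ (n ∸ t) f
∑-shift zero    n       f = refl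
∑-shift (suc t) zero    f = refl
∑-shift (suc t) (suc n) f = ∑-shift t n f

∑-list-comm : ∀ n (f : ℕ → ℕ → ℕ) xs →
  ∑ n (λ a → sum (map (λ x → f x a) xs)) ≡ sum (map (λ x → ∑ n (f x)) xs)
∑-list-comm n f []       = ∑-zero n
∑-list-comm n f (x ∷ xs) = trans (∑-distrib-+ n (f x) _) (cong (∑ n (f x) +_) (∑-list-comm n f xs))

shift-+ : ∀ t f n → shift t f (t + n) ≡ f n
shift-+ zero    f n = refl
shift-+ (suc t) f n = shift-+ t f n

shift-view : ∀ t f n → shift t f n ≡ 0 ⊎ ∃[ b ] n ≡ t + b
shift-view zero    f n       = inj₂ (n , refl)
shift-view (suc t) f zero    = inj₁ refl
shift-view (suc t) f (suc n) with shift-view t f n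
... | inj₁ eq       = inj₁ eq
... | inj₂ (b , eq) = inj₂ (b , cong suc eq)

-- Abel summation, with the term f a · a written as f a · (a + 1) to avoid subtraction.
∑-by-parts : ∀ n f → ∑ n (λ a → f a * suc a) + ∑ n (λ t → ∑ t f) ≡ n * ∑ n f
∑-by-parts zero    f = refl
∑-by-parts (suc n) f
  rewrite ∑-suc n (λ a → f a * suc a) | ∑-suc n (λ t → ∑ t f) | ∑-suc n f = begin
    (U + f n * suc n) + (V + S)  ≡⟨ +-interchange U (f n * suc n) V S ⟩
    (U + V) + (f n * suc n + S)  ≡⟨ cong (_+ (f n * suc n + S)) (∑-by-parts n f) ⟩
    n * S + (f n * suc n + S)    ≡⟨ lemma n S (f n) ⟩
    suc n * (S + f n)            ∎
  where
  open ≡-Reasoning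
  U V S : ℕ
  U = ∑ n (λ a → f a * suc a)
  V = ∑ n (λ t → ∑ t f)
  S = ∑ n f
  lemma : ∀ n S x → n * S + (x * suc n + S) ≡ suc n * (S + x)
  lemma = solve-∀

-- The terms are the left endpoints of blocks of length h.
∑-blocks : ∀ (G : ℕ → ℕ) → G 0 ≡ 0 → (∀ {s t} → s ≤ t → G s ≤ G t) →
  ∀ h J N → h * ∑ J (λ j → G (N ∸ suc j * h)) ≤ ∑ N G
∑-blocks G G0 mono h zero    N rewrite *-zeroʳ h = z≤n
∑-blocks G G0 mono h (suc J) N = begin
  h * (G (N ∸ (h + 0)) + ∑ J (λ j → G (N ∸ (h + suc j * h))))
    ≡⟨ *-distribˡ-+ h _ _ ⟩
  h * G (N ∸ (h + 0)) + h * ∑ J (λ j → G (N ∸ (h + suc j * h)))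
    ≡⟨ cong₂ (λ x y → h * G (N ∸ x) + h * y) (+-identityʳ h)
         (∑-cong J λ j → cong G (sym (∸-+-assoc N h (suc j * h)))) ⟩
  h * G (N ∸ h) + h * ∑ J (λ j → G (N ∸ h ∸ suc j * h))
    ≤⟨ +-monoʳ-≤ (h * G (N ∸ h)) (∑-blocks G G0 mono h J (N ∸ h)) ⟩
  h * G (N ∸ h) + ∑ (N ∸ h) G
    ≤⟨ last-block (≤-total h N) ⟩
  ∑ N G ∎
  where
  open ≤-Reasoning
  last-block : h ≤ N ⊎ N ≤ h → h * G (N ∸ h) + ∑ (N ∸ h) G ≤ ∑ N G
  -- A block that would begin at or below 0 is read at 0 by truncated subtraction, and there G
  -- vanishes.
  last-block (inj₂ N≤h) rewrite m≤n⇒m∸n≡0 N≤h | G0 | *-zeroʳ h = z≤n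
  last-block (inj₁ h≤N) = begin
    h * G (N ∸ h) + ∑ (N ∸ h) G
      ≡⟨ +-comm (h * G (N ∸ h)) _ ⟩
    ∑ (N ∸ h) G + h * G (N ∸ h)
      ≡⟨ cong (∑ (N ∸ h) G +_) (sym (∑-const h _)) ⟩
    ∑ (N ∸ h) G + ∑ h (const (G (N ∸ h)))
      ≤⟨ +-monoʳ-≤ (∑ (N ∸ h) G) (∑-mono h λ i _ → mono (m≤m+n (N ∸ h) i)) ⟩
    ∑ (N ∸ h) G + ∑ h (λ i → G (N ∸ h + i))
      ≡⟨ ∑-+ (N ∸ h) h G ⟨
    ∑ (N ∸ h + h) G
      ≡⟨ cong (λ n → ∑ n G) (m∸n+n≡m h≤N) ⟩
    ∑ N G ∎

-- Sums over lists and indicator functions.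

sum-map-≤ : ∀ (f : ℕ → ℕ) E xs → (∀ {x} → x ∈ xs → f x ≤ E) → sum (map f xs) ≤ length xs * E
sum-map-≤ f E []       f≤E = z≤n
sum-map-≤ f E (x ∷ xs) f≤E = +-mono-≤ (f≤E (here refl)) (sum-map-≤ f E xs (f≤E ∘ there))

-- One vanishing summand saves one copy of the bound; this is where the factor k - 1 arises, with E
-- added on the left to avoid subtraction.
sum-map-vanishing : ∀ (f : ℕ → ℕ) E {x xs} → (∀ {y} → y ∈ xs → f y ≤ E) → x ∈ xs → f x ≡ 0 →
  sum (map f xs) + E ≤ length xs * E
sum-map-vanishing f E {xs = x ∷ xs} f≤E (here refl) fx≡0
  rewrite fx≡0 | +-comm (sum (map f xs)) E = +-monoʳ-≤ E (sum-map-≤ f E xs (f≤E ∘ there))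
sum-map-vanishing f E {xs = y ∷ xs} f≤E (there x∈xs) fx≡0
  rewrite +-assoc (f y) (sum (map f xs)) E =
  +-mono-≤ (f≤E (here refl)) (sum-map-vanishing f E (f≤E ∘ there) x∈xs fx≡0)

*-sum-map : ∀ x (f : ℕ → ℕ) ys → x * sum (map f ys) ≡ sum (map (λ y → x * f y) ys)
*-sum-map x f []       = *-zeroʳ x
*-sum-map x f (y ∷ ys) = trans (*-distribˡ-+ x (f y) _) (cong (x * f y +_) (*-sum-map x f ys))

indicator : {P : Set} → Dec P → ℕ
indicator (yes _) = 1
indicator (no _)  = 0

indicator-yes : {P : Set} (P? : Dec P) → P → indicator P? ≡ 1
indicator-yes (yes _) p = refl
indicator-yes (no ¬p) p = contradiction p ¬p

indicator≤1 : {P : Set} (P? : Dec P) → indicator P? ≤ 1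
indicator≤1 (yes _) = ≤-refl
indicator≤1 (no _)  = z≤n

indicator-mono : {P Q : Set} (P? : Dec P) (Q? : Dec Q) → (P → Q) → indicator P? ≤ indicator Q?
indicator-mono (yes p) Q? P→Q = ≤-reflexive (sym (indicator-yes Q? (P→Q p)))
indicator-mono (no _)  Q? P→Q = z≤n

length-filter-upTo : {P : Pred ℕ 0ℓ} (P? : Decidable P) → ∀ n →
  length (filter P? (upTo n)) ≡ ∑ n (λ i → indicator (P? i))
length-filter-upTo P? zero    = refl
length-filter-upTo P? (suc n) = begin
  length (filter P? (upTo (suc n)))
    ≡⟨ cong (length ∘ filter P?) (sym (upTo-∷ʳ n)) ⟩
  length (filter P? (upTo n ∷ʳ n))
    ≡⟨ cong length (filter-++ P? (upTo n) (n ∷ [])) ⟩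
  length (filter P? (upTo n) ++ filter P? (n ∷ []))
    ≡⟨ length-++ (filter P? (upTo n)) ⟩
  length (filter P? (upTo n)) + length (filter P? (n ∷ []))
    ≡⟨ cong₂ _+_ (length-filter-upTo P? n) (singleton (P? n)) ⟩
  ∑ n (λ i → indicator (P? i)) + indicator (P? n)
    ≡⟨ ∑-suc n (λ i → indicator (P? i)) ⟨
  ∑ (suc n) (λ i → indicator (P? i)) ∎
  where
  open ≡-Reasoning
  singleton : ∀ d → length (filter P? (n ∷ [])) ≡ indicator (P? n)
  singleton d with P? n
  ... | yes _ = refl
  ... | no _  = refl

-- Elements past the conductor and combinations of generators.

conductor≤⇒∈ : ∀ Λ {a} → conductor Λ ≤ a → carrier Λ a
conductor≤⇒∈ Λ {a} c≤a with carrier? Λ a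
... | yes a∈Λ = a∈Λ
... | no  a∉Λ = contradiction (≤-trans a<c c≤a) (<-irrefl refl)
  where
  a<c : a < conductor Λ
  a<c = All.lookup (xs≤max 0 (map suc (gaps Λ)))
    (∈-map⁺ suc (∈-filter⁺ (λ n → ¬? (carrier? Λ n)) (proj₂ (cofinite Λ) a∉Λ) a∉Λ))

Combination : List ℕ → ℕ → Set
Combination []       a = a ≡ 0
Combination (h ∷ hs) a = ∃[ x ] ∃[ b ] Combination hs b × a ≡ x * h + b

combination-0 : ∀ hs → Combination hs 0
combination-0 []       = refl
combination-0 (h ∷ hs) = 0 , 0 , combination-0 hs , refl

combination-∈ : ∀ {h hs} → h ∈ hs → Combination hs h
combination-∈ {h} {_ ∷ hs} (here refl) = 1 , 0 , combination-0 hs ,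
  sym (trans (+-identityʳ (1 * h)) (*-identityˡ h))
combination-∈ {h} (there h∈hs) = 0 , h , combination-∈ h∈hs , refl

combination-+ : ∀ hs {a b} → Combination hs a → Combination hs b → Combination hs (a + b)
combination-+ []       refl refl = refl
combination-+ (h ∷ hs) (x , a , ca , refl) (y , b , cb , refl) =
  x + y , a + b , combination-+ hs ca cb , lemma x y h a b
  where
  lemma : ∀ x y h a b → (x * h + a) + (y * h + b) ≡ (x + y) * h + (a + b)
  lemma = solve-∀

⟨⟩⇒combination : ∀ {hs a} → ⟨ _∈ hs ⟩ a → Combination hs a
⟨⟩⇒combination      (gen h∈hs) = combination-∈ h∈hs
⟨⟩⇒combination {hs} zero       = combination-0 hs
⟨⟩⇒combination {hs} (add p q)  = combination-+ hs (⟨⟩⇒combination p) (⟨⟩⇒combination q)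

combination-zeros : ∀ {hs a} → All (_≡ 0) hs → Combination hs a → a ≡ 0
combination-zeros []          a≡0               = a≡0
combination-zeros (refl ∷ ps) (x , b , cb , refl)
  rewrite *-zeroʳ x = combination-zeros ps cb

-- The number of coefficient vectors with entries from 0 to T whose combination is a.
#combinations : ℕ → List ℕ → ℕ → ℕ
#combinations T []       a = indicator (a ≟ 0)
#combinations T (h ∷ hs) a = ∑ (suc T) (λ x → shift (x * h) (#combinations T hs) a)

-- A coefficient vector determines its a, so the sum counts each of the (T + 1)^k vectors at most
-- once, where k is the length of hs.
∑-#combinations : ∀ T hs n → ∑ n (#combinations T hs) ≤ suc T ^ length hs
∑-#combinations T []       zero    = z≤n
∑-#combinations T []       (suc n) = ≤-reflexive (cong suc (∑-zero n))
∑-#combinations T (h ∷ hs) n = begin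
  ∑ n (λ a → ∑ (suc T) (λ x → shift (x * h) (#combinations T hs) a))
    ≡⟨ ∑-comm n (suc T) (λ a x → shift (x * h) (#combinations T hs) a) ⟩
  ∑ (suc T) (λ x → ∑ n (shift (x * h) (#combinations T hs)))
    ≡⟨ ∑-cong (suc T) (λ x → ∑-shift (x * h) n (#combinations T hs)) ⟩
  ∑ (suc T) (λ x → ∑ (n ∸ x * h) (#combinations T hs))
    ≤⟨ ∑-mono (suc T) (λ x _ → ∑-#combinations T hs (n ∸ x * h)) ⟩
  ∑ (suc T) (const (suc T ^ length hs))
    ≡⟨ ∑-const (suc T) _ ⟩
  suc T ^ suc (length hs) ∎
  where open ≤-Reasoning

-- A coefficient x of a generator h ≥ m satisfies x h ≤ a < (T + 1) m ≤ (T + 1) h, hence x ≤ T.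
#combinations>0 : ∀ T {m hs a} → All (λ h → h ≡ 0 ⊎ m ≤ h) hs → Combination hs a →
  a < suc T * m → 0 < #combinations T hs a
#combinations>0 T [] refl a< = z<s
-- The coefficient of a generator 0 may exceed T, but it can be replaced by 0 without changing a.
#combinations>0 T {hs = _ ∷ hs} (inj₁ refl ∷ ps) (x , b , cb , refl) a<
  rewrite *-zeroʳ x =
  ≤-trans (#combinations>0 T ps cb a<) (m≤m+n (#combinations T hs b) _)
#combinations>0 T {m} {h ∷ hs} (inj₂ m≤h ∷ ps) (x , b , cb , refl) a< = begin
  1
    ≤⟨ #combinations>0 T ps cb (≤-<-trans (m≤n+m b (x * h)) a<) ⟩
  #combinations T hs b
    ≡⟨ shift-+ (x * h) (#combinations T hs) b ⟨
  shift (x * h) (#combinations T hs) (x * h + b)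
    ≤⟨ term≤∑ (λ y → shift (y * h) (#combinations T hs) (x * h + b)) x≤T ⟩
  #combinations T (h ∷ hs) (x * h + b) ∎
  where
  open ≤-Reasoning
  x≤T : x < suc T
  x≤T = *-cancelʳ-< h x (suc T) (begin-strict
    x * h      ≤⟨ m≤m+n (x * h) b ⟩
    x * h + b  <⟨ a< ⟩
    suc T * m  ≤⟨ *-monoʳ-≤ (suc T) m≤h ⟩
    suc T * h  ∎)

least-positive : ∀ gs → All (_≡ 0) gs ⊎
  (∃[ m ] m ∈ gs × 0 < m × All (λ h → h ≡ 0 ⊎ m ≤ h) gs)
least-positive []           = inj₁ []
least-positive (zero  ∷ gs) with least-positive gs
... | inj₁ zeros                   = inj₁ (refl ∷ zeros)
... | inj₂ (m , m∈gs , 0<m , m≤gs) = inj₂ (m , there m∈gs , 0<m , inj₁ refl ∷ m≤gs)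
least-positive (suc g ∷ gs) with least-positive gs
... | inj₁ zeros = inj₂ (suc g , here refl , z<s , inj₂ ≤-refl ∷ All.map inj₁ zeros)
... | inj₂ (m , m∈gs , 0<m , m≤gs) with ≤-total m (suc g)
...   | inj₁ m≤g = inj₂ (m , there m∈gs , 0<m , inj₂ m≤g ∷ m≤gs)
...   | inj₂ g≤m = inj₂ (suc g , here refl , z<s ,
                         inj₂ ≤-refl ∷ All.map (Sum.map₂ (≤-trans g≤m)) m≤gs)

-- The Apéry set of m and its counting function.

module Apéry (Λ : NumericalSemigroup) (m : ℕ) (m∈Λ : carrier Λ m) where

  L : ℕ → ℕ
  L a = indicator (carrier? Λ a)

  L-mono : ∀ {t} b → carrier Λ t → L b ≤ L (t + b)
  L-mono {t} b t∈Λ = indicator-mono (carrier? Λ b) (carrier? Λ (t + b)) (+-closed Λ t∈Λ)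

  shift-L≤L : ∀ {t} a → carrier Λ t → shift t L a ≤ L a
  shift-L≤L {t} a t∈Λ with shift-view t L a
  ... | inj₁ eq         rewrite eq            = z≤n
  ... | inj₂ (b , refl) rewrite shift-+ t L b = L-mono b t∈Λ

  shift-L-mono : ∀ s {t} b → carrier Λ t → shift s L b ≤ shift s L (t + b)
  shift-L-mono s {t} b t∈Λ with shift-view s L b
  ... | inj₁ eq rewrite eq = z≤n
  ... | inj₂ (b′ , refl)
    rewrite shift-+ s L b′ | sym (+-assoc t s b′) | +-comm t s | +-assoc s t b′
          | shift-+ s L (t + b′) = L-mono b′ t∈Λ

  -- The indicator of the Apéry set of m, that is, of the a ∈ Λ with a − m ∉ Λ.
  A : ℕ → ℕ
  A a = L a ∸ shift m L a

  A-∉ : ∀ {a} → ¬ carrier Λ a → A a ≡ 0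
  A-∉ {a} a∉Λ with carrier? Λ a
  ... | yes a∈Λ = contradiction a∈Λ a∉Λ
  ... | no  _   = 0∸n≡0 (shift m L a)

  A+shift-L : ∀ a → A a + shift m L a ≡ L a
  A+shift-L a = m∸n+n≡m (shift-L≤L a m∈Λ)

  -- If a = t + b is an Apéry element and b ∈ Λ, then b is one too: b - m ∈ Λ would give a - m ∈ Λ
  -- on adding t.
  A*shift-L≤shift-A : ∀ {t} a → carrier Λ t → A a * shift t L a ≤ shift t A a
  A*shift-L≤shift-A {t} a t∈Λ with shift-view t L a
  ... | inj₁ eq rewrite eq | *-zeroʳ (A a) = z≤n
  ... | inj₂ (b , refl) rewrite shift-+ t L b | shift-+ t A b with carrier? Λ b
  ...   | no  _   rewrite *-zeroʳ (A (t + b)) = z≤n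
  ...   | yes _   rewrite *-identityʳ (A (t + b)) =
    ∸-mono (indicator≤1 (carrier? Λ (t + b))) (shift-L-mono m b t∈Λ)

  multiple∈Λ : ∀ {t} j → carrier Λ t → carrier Λ (j * t)
  multiple∈Λ zero    t∈Λ = 0∈ Λ
  multiple∈Λ (suc j) t∈Λ = +-closed Λ t∈Λ (multiple∈Λ j t∈Λ)

  -- If a - (j + 1) m lies in Λ, then adding j m shows a - m ∈ Λ, so a is not an Apéry element.
  A*shift-L-multiple≡0 : ∀ j a → A a * shift (suc j * m) L a ≡ 0
  A*shift-L-multiple≡0 j a with shift-view (suc j * m) L a
  ... | inj₁ eq rewrite eq = *-zeroʳ (A a)
  ... | inj₂ (b , refl) rewrite shift-+ (suc j * m) L b with carrier? Λ b
  ...   | no  _   = *-zeroʳ (A (suc j * m + b))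
  ...   | yes b∈Λ
    rewrite +-assoc m (j * m) b | shift-+ m L (j * m + b)
          | indicator-yes (carrier? Λ (j * m + b)) (+-closed Λ (multiple∈Λ j m∈Λ) b∈Λ)
          | m≤n⇒m∸n≡0 (indicator≤1 (carrier? Λ (m + (j * m + b)))) = refl

  -- For a ≥ `N` the difference a - m is at least the conductor, so the whole Apéry set lies below
  -- `N`.
  c N : ℕ
  c = conductor Λ
  N = m + c

  #Λ #A : ℕ → ℕ
  #Λ n = ∑ n L
  #A n = ∑ n A

  #Λ-conductor : #Λ c ≡ c′ Λ
  #Λ-conductor = sym (length-filter-upTo (carrier? Λ) c)

  #Λ-+ : ∀ i → #Λ (c + i) ≡ #Λ c + i
  #Λ-+ i = begin
    #Λ (c + i)                         ≡⟨ ∑-+ c i L ⟩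
    #Λ c + ∑ i (λ j → L (c + j))       ≡⟨ cong (#Λ c +_) (∑-cong i λ j →
      indicator-yes (carrier? Λ (c + j)) (conductor≤⇒∈ Λ (m≤m+n c j))) ⟩
    #Λ c + ∑ i (const 1)               ≡⟨ cong (#Λ c +_) (∑-const i 1) ⟩
    #Λ c + i * 1                       ≡⟨ cong (#Λ c +_) (*-identityʳ i) ⟩
    #Λ c + i                           ∎
    where open ≡-Reasoning

  #A+#Λ : ∀ n → #A n + #Λ (n ∸ m) ≡ #Λ n
  #A+#Λ n = begin
    #A n + #Λ (n ∸ m)                ≡⟨ cong (#A n +_) (∑-shift m n L) ⟨
    #A n + ∑ n (shift m L)           ≡⟨ ∑-distrib-+ n A (shift m L) ⟨
    ∑ n (λ a → A a + shift m L a)    ≡⟨ ∑-cong n A+shift-L ⟩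
    #Λ n                             ∎
    where open ≡-Reasoning

  -- No residue classes are needed: `#A N` is the difference of the counts of Λ below m + c and
  -- below c, and Λ contains all m numbers in between.
  #A-N : #A N ≡ m
  #A-N = +-cancelʳ-≡ (#Λ c) (#A N) m (begin
    #A N + #Λ c          ≡⟨ cong (λ n → #A N + #Λ n) (m+n∸m≡n m c) ⟨
    #A N + #Λ (N ∸ m)    ≡⟨ #A+#Λ N ⟩
    #Λ (m + c)           ≡⟨ cong #Λ (+-comm m c) ⟩
    #Λ (c + m)           ≡⟨ #Λ-+ m ⟩
    #Λ c + m             ≡⟨ +-comm (#Λ c) m ⟩
    m + #Λ c             ∎)
    where open ≡-Reasoning

  -- This is the sum of N − 1 − w over the Apéry set.
  E : ℕ
  E = ∑ N #A

  -- Summing `#A+#Λ` over all t < `N` and cancelling `∑ c #Λ` leaves only the m values `#Λ (c + i)`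
  -- with i < m, each at most c′ + m.
  E≤ : E ≤ m * (c′ Λ + m)
  E≤ = +-cancelʳ-≤ (∑ c #Λ) E (m * (c′ Λ + m)) (begin
    E + ∑ c #Λ
      ≡⟨ cong (E +_) (∑-cong c λ i → cong #Λ (sym (m+n∸m≡n m i))) ⟩
    E + ∑ c (λ i → #Λ (m + i ∸ m))
      ≤⟨ +-monoʳ-≤ E (m≤n+m _ (∑ m (λ t → #Λ (t ∸ m)))) ⟩
    E + (∑ m (λ t → #Λ (t ∸ m)) + ∑ c (λ i → #Λ (m + i ∸ m)))
      ≡⟨ cong (E +_) (∑-+ m c (λ t → #Λ (t ∸ m))) ⟨
    E + ∑ N (λ t → #Λ (t ∸ m))
      ≡⟨ ∑-distrib-+ N #A (λ t → #Λ (t ∸ m)) ⟨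
    ∑ N (λ t → #A t + #Λ (t ∸ m))
      ≡⟨ ∑-cong N #A+#Λ ⟩
    ∑ (m + c) #Λ
      ≡⟨ cong (λ n → ∑ n #Λ) (+-comm m c) ⟩
    ∑ (c + m) #Λ
      ≡⟨ ∑-+ c m #Λ ⟩
    ∑ c #Λ + ∑ m (λ i → #Λ (c + i))
      ≤⟨ +-monoʳ-≤ (∑ c #Λ) (∑-mono m λ i i<m → ≤-trans (≤-reflexive (#Λ-+ i))
           (+-mono-≤ (≤-reflexive #Λ-conductor) (<⇒≤ i<m))) ⟩
    ∑ c #Λ + ∑ m (const (c′ Λ + m))
      ≡⟨ cong (∑ c #Λ +_) (∑-const m _) ⟩
    ∑ c #Λ + m * (c′ Λ + m)
      ≡⟨ +-comm (∑ c #Λ) _ ⟩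
    m * (c′ Λ + m) + ∑ c #Λ ∎)
    where open ≤-Reasoning

  -- How often h can be subtracted from a without leaving Λ (at most N times).
  order : ℕ → ℕ → ℕ
  order h a = ∑ N (λ j → shift (suc j * h) L a)

  -- Subtracting j h from an element of the Apéry set gives another one if the
  -- result lies in Λ, so the pairs (a, j) counted on the left are
  -- reparametrised by (a − j h, j).
  ∑-order≤E : ∀ h → carrier Λ h → ∑ N (λ a → A a * (order h a * h)) ≤ E
  ∑-order≤E h h∈Λ = begin
    ∑ N (λ a → A a * (order h a * h))
      ≡⟨ ∑-cong N (λ a → sym (*-assoc (A a) (order h a) h)) ⟩
    ∑ N (λ a → A a * order h a * h)
      ≡⟨ ∑-*ʳ N (λ a → A a * order h a) h ⟩
    ∑ N (λ a → A a * order h a) * h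
      ≡⟨ cong (_* h) (∑-cong N λ a → sym (∑-*ˡ N (λ j → shift (suc j * h) L a) (A a))) ⟩
    ∑ N (λ a → ∑ N (λ j → A a * shift (suc j * h) L a)) * h
      ≤⟨ *-monoˡ-≤ h (∑-mono N λ a _ → ∑-mono N λ j _ →
           A*shift-L≤shift-A a (multiple∈Λ (suc j) h∈Λ)) ⟩
    ∑ N (λ a → ∑ N (λ j → shift (suc j * h) A a)) * h
      ≡⟨ cong (_* h) (∑-comm N N (λ a j → shift (suc j * h) A a)) ⟩
    ∑ N (λ j → ∑ N (shift (suc j * h) A)) * h
      ≡⟨ cong (_* h) (∑-cong N λ j → ∑-shift (suc j * h) N A) ⟩
    ∑ N (λ j → #A (N ∸ suc j * h)) * h
      ≡⟨ *-comm _ h ⟩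
    h * ∑ N (λ j → #A (N ∸ suc j * h))
      ≤⟨ ∑-blocks #A refl (∑-monoˡ A) h N N ⟩
    E ∎
    where open ≤-Reasoning

  ∑-order-m≡0 : ∑ N (λ a → A a * (order m a * m)) ≡ 0
  ∑-order-m≡0 = begin
    ∑ N (λ a → A a * (order m a * m))
      ≡⟨ ∑-cong N (λ a → sym (*-assoc (A a) (order m a) m)) ⟩
    ∑ N (λ a → A a * order m a * m)
      ≡⟨ ∑-cong N (λ a → cong (_* m) (trans
           (sym (∑-*ˡ N (λ j → shift (suc j * m) L a) (A a)))
           (trans (∑-cong N λ j → A*shift-L-multiple≡0 j a) (∑-zero N)))) ⟩
    ∑ N (const 0)
      ≡⟨ ∑-zero N ⟩
    0 ∎
    where open ≡-Reasoning

  -- Subtracting h up to x times stays in Λ. For h > 0 these steps are all within the range of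
  -- `order`, as x ≤ x h < `N`; for h = 0 both sides vanish.
  coefficient≤order : ∀ h x b → carrier Λ h → carrier Λ b → x * h + b < N →
    x * h ≤ order h (x * h + b) * h
  coefficient≤order zero x b _ _ _ rewrite *-zeroʳ x = z≤n
  coefficient≤order h@(suc _) x b h∈Λ b∈Λ a<N = *-monoˡ-≤ h (begin
    x
      ≡⟨ trans (∑-const x 1) (*-identityʳ x) ⟨
    ∑ x (const 1)
      ≤⟨ ∑-mono x (λ j j<x → ≤-reflexive (sym (subtractable j (m≤n⇒∃[o]m+o≡n j<x)))) ⟩
    ∑ x (λ j → shift (suc j * h) L (x * h + b))
      ≤⟨ ∑-monoˡ (λ j → shift (suc j * h) L (x * h + b)) x≤N ⟩
    order h (x * h + b) ∎)
    where
    open ≤-Reasoning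
    x≤N : x ≤ N
    x≤N = ≤-trans (m≤m*n x h) (≤-trans (m≤m+n (x * h) b) (<⇒≤ a<N))
    subtractable : ∀ j → ∃[ i ] suc j + i ≡ x → shift (suc j * h) L (x * h + b) ≡ 1
    subtractable j (i , refl) = trans
      (cong (shift (suc j * h) L) (lemma j i h b))
      (trans (shift-+ (suc j * h) L (i * h + b))
        (indicator-yes (carrier? Λ (i * h + b)) (+-closed Λ (multiple∈Λ i h∈Λ) b∈Λ)))
      where
      lemma : ∀ j i h b → (suc j + i) * h + b ≡ suc j * h + (i * h + b)
      lemma = solve-∀

  -- The element b collects the generators already split off, so that every order in the induction
  -- is taken at the same total r + b.
  combination≤∑order : ∀ {hs} r b → All (carrier Λ) hs → Combination hs r → carrier Λ b →
    r + b < N → r ≤ sum (map (λ h → order h (r + b) * h) hs)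
  combination≤∑order r b [] refl b∈Λ a<N = z≤n
  combination≤∑order {h ∷ hs} _ b (h∈Λ ∷ hs∈Λ) (x , r , cr , refl) b∈Λ a<N = +-mono-≤
    (subst (λ a → x * h ≤ order h a * h) (sym (+-assoc (x * h) r b))
      (coefficient≤order h x (r + b) h∈Λ (+-closed Λ (combination∈Λ hs∈Λ cr) b∈Λ)
        (subst (_< N) (+-assoc (x * h) r b) a<N)))
    (subst (λ a → r ≤ sum (map (λ h → order h a * h) hs)) eq
      (combination≤∑order r (x * h + b) hs∈Λ cr (+-closed Λ (multiple∈Λ x h∈Λ) b∈Λ)
        (subst (_< N) (sym eq) a<N)))
    where
    combination∈Λ : ∀ {hs r} → All (carrier Λ) hs → Combination hs r → carrier Λ r
    combination∈Λ []            refl               = 0∈ Λ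
    combination∈Λ (h∈Λ ∷ hs∈Λ) (x , r , cr , refl) =
      +-closed Λ (multiple∈Λ x h∈Λ) (combination∈Λ hs∈Λ cr)
    lemma : ∀ r y b → r + (y + b) ≡ y + r + b
    lemma = solve-∀
    eq : r + (x * h + b) ≡ x * h + r + b
    eq = lemma r (x * h) b

  -- Bounds on the conductor and on m from a generating list.

  module _ {gs : List ℕ} (gs-generate : (_∈ gs) Generates Λ) where

    combination : ∀ {a} → carrier Λ a → Combination gs a
    combination = ⟨⟩⇒combination ∘ proj₂ gs-generate

    gs∈Λ : ∀ {g} → g ∈ gs → carrier Λ g
    gs∈Λ = proj₁ gs-generate ∘ gen

    A*a≤ : ∀ a → a < N → A a * a ≤ sum (map (λ h → A a * (order h a * h)) gs)
    A*a≤ a a<N = ≤-trans (bound (carrier? Λ a)) (≤-reflexive (*-sum-map (A a) _ gs))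
      where
      bound : Dec (carrier Λ a) → A a * a ≤ A a * sum (map (λ h → order h a * h) gs)
      bound (yes a∈Λ) = *-monoʳ-≤ (A a)
        (subst (λ b → a ≤ sum (map (λ h → order h b * h) gs)) (+-identityʳ a) (combination≤∑order a 0 (All.tabulate gs∈Λ) (combination a∈Λ) (0∈ Λ)
          (subst (_< N) (sym (+-identityʳ a)) a<N)))
      bound (no a∉Λ) rewrite A-∉ a∉Λ = z≤n

    -- The summand for the generator m vanishes, which improves the trivial
    -- factor length gs by one.
    ∑A*a+E≤ : m ∈ gs → ∑ N (λ a → A a * a) + E ≤ length gs * E
    ∑A*a+E≤ m∈gs = begin
      ∑ N (λ a → A a * a) + E
        ≤⟨ +-monoˡ-≤ E (∑-mono N A*a≤) ⟩
      ∑ N (λ a → sum (map (λ h → A a * (order h a * h)) gs)) + E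
        ≡⟨ cong (_+ E) (∑-list-comm N (λ h a → A a * (order h a * h)) gs) ⟩
      sum (map (λ h → ∑ N (λ a → A a * (order h a * h))) gs) + E
        ≤⟨ sum-map-vanishing (λ h → ∑ N (λ a → A a * (order h a * h))) E
             (λ {h} h∈gs → ∑-order≤E h (gs∈Λ h∈gs)) m∈gs ∑-order-m≡0 ⟩
      length gs * E ∎
      where open ≤-Reasoning

    -- Abel summation turns m N into m + Σ w + E, which is at most m + k E, and `E≤` bounds E.
    -- Dividing by m gives m + c ≤ 1 + k (c′ + m), and m ≥ 1 absorbs the 1.
    conductor≤ : m ∈ gs → 0 < m → conductor Λ ≤ length gs * (c′ Λ + m)
    conductor≤ m∈gs 0<m = +-cancelˡ-≤ 1 c _ (begin
      1 + c                          ≤⟨ +-monoˡ-≤ c 0<m ⟩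
      N                              ≤⟨ *-cancelˡ-≤ m {{>-nonZero 0<m}} m*N≤ ⟩
      1 + length gs * (c′ Λ + m)     ∎)
      where
      open ≤-Reasoning
      k : ℕ
      k = length gs
      lemma : ∀ m k x → m + k * (m * x) ≡ m * (1 + k * x)
      lemma = solve-∀
      m*N≤ : m * N ≤ m * (1 + k * (c′ Λ + m))
      m*N≤ = begin
        m * N
          ≡⟨ *-comm m N ⟩
        N * m
          ≡⟨ cong (N *_) #A-N ⟨
        N * #A N
          ≡⟨ ∑-by-parts N A ⟨
        ∑ N (λ a → A a * suc a) + E
          ≡⟨ cong (_+ E) (trans (∑-cong N λ a → *-suc (A a) a) (∑-distrib-+ N A (λ a → A a * a))) ⟩
        #A N + ∑ N (λ a → A a * a) + E
          ≡⟨ +-assoc (#A N) _ E ⟩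
        #A N + (∑ N (λ a → A a * a) + E)
          ≤⟨ +-mono-≤ (≤-reflexive #A-N) (∑A*a+E≤ m∈gs) ⟩
        m + k * E
          ≤⟨ +-monoʳ-≤ m (*-monoʳ-≤ k E≤) ⟩
        m + k * (m * (c′ Λ + m))
          ≡⟨ lemma m k (c′ Λ + m) ⟩
        m * (1 + k * (c′ Λ + m)) ∎

    -- All m Apéry elements are below m + c < (T + 1) m, so each has a coefficient vector with
    -- entries at most T, and different elements have different vectors.
    multiplicity≤ : ∀ T → All (λ h → h ≡ 0 ⊎ m ≤ h) gs → conductor Λ < T * m →
      m ≤ suc T ^ length gs
    multiplicity≤ T m≤gs c<Tm = begin
      m                           ≡⟨ #A-N ⟨
      #A N                        ≤⟨ ∑-mono N A≤#combinations ⟩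
      ∑ N (#combinations T gs)    ≤⟨ ∑-#combinations T gs N ⟩
      suc T ^ length gs           ∎
      where
      open ≤-Reasoning
      A≤#combinations : ∀ a → a < N → A a ≤ #combinations T gs a
      A≤#combinations a a<N = ≤-trans (m∸n≤m (L a) (shift m L a)) L≤
        where
        L≤ : L a ≤ #combinations T gs a
        L≤ with carrier? Λ a
        ... | no _    = z≤n
        ... | yes a∈Λ = #combinations>0 T m≤gs (combination a∈Λ)
                          (<-trans a<N (+-monoʳ-< m c<Tm))

-- Finiteness of the set of semigroups with bounded conductor.

sublists : List ℕ → List (List ℕ)
sublists []       = [] ∷ []
sublists (x ∷ xs) = sublists xs ++ map (x ∷_) (sublists xs)

filter∈sublists : {P : Pred ℕ 0ℓ} (P? : Decidable P) → ∀ xs → filter P? xs ∈ sublists xs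
filter∈sublists P? []       = here refl
filter∈sublists P? (x ∷ xs) with P? x
... | yes _ = ∈-++⁺ʳ (sublists xs) (∈-map⁺ (x ∷_) (filter∈sublists P? xs))
... | no  _ = ∈-++⁺ˡ (filter∈sublists P? xs)

-- The n with n + X ⊆ X, where X consists of xs and all integers from B on.
-- This is a numerical semigroup for any xs, and it is X if X is one.
stabilizer : ℕ → List ℕ → NumericalSemigroup
stabilizer B xs = record
  { carrier  = λ n → All (λ s → X (n + s)) xs
  ; carrier? = λ n → all? (λ s → (B ≤? n + s) ⊎-dec (n + s ∈? xs)) xs
  ; 0∈       = All.tabulate inj₂
  ; +-closed = λ {m} {n} m∈ n∈ → All.map (λ {s} → step {m} {n} {s} m∈) n∈
  ; cofinite = upTo B , λ n∉ → ∈-upTo⁺ (≰⇒> λ B≤n →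
      n∉ (All.tabulate λ {s} _ → inj₁ (m≤n⇒m≤n+o s B≤n)))
  }
  where
  X : ℕ → Set
  X n = B ≤ n ⊎ n ∈ xs
  step : ∀ {m n s} → All (λ s → X (m + s)) xs → X (n + s) → X (m + n + s)
  step {m} {n} {s} m∈ x rewrite +-assoc m n s with x
  ... | inj₁ B≤n+s  = inj₁ (m≤n⇒m≤o+n m B≤n+s)
  ... | inj₂ n+s∈xs = All.lookup m∈ n+s∈xs

-- Closure under addition gives one inclusion. For the other, `0 < B` puts 0 into xs, and the
-- condition at s = 0 says that a itself is in xs or at least B.
≈-stabilizer : ∀ Λ {B} → 0 < B → conductor Λ ≤ B →
  Λ ≈ stabilizer B (filter (carrier? Λ) (upTo B))
≈-stabilizer Λ {B} 0<B c≤B = to , from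
  where
  xs : List ℕ
  xs = filter (carrier? Λ) (upTo B)
  to : ∀ {a} → carrier Λ a → All (λ s → B ≤ a + s ⊎ a + s ∈ xs) xs
  to {a} a∈Λ = All.tabulate λ {s} s∈xs →
    classify (+-closed Λ a∈Λ (proj₂ (∈-filter⁻ (carrier? Λ) {xs = upTo B} s∈xs)))
    where
    classify : ∀ {b} → carrier Λ b → B ≤ b ⊎ b ∈ xs
    classify {b} b∈Λ with B ≤? b
    ... | yes B≤b = inj₁ B≤b
    ... | no  B≰b = inj₂ (∈-filter⁺ (carrier? Λ) (∈-upTo⁺ (≰⇒> B≰b)) b∈Λ)
  from : ∀ {a} → All (λ s → B ≤ a + s ⊎ a + s ∈ xs) xs → carrier Λ a
  from {a} a∈ with All.lookup a∈ (∈-filter⁺ (carrier? Λ) (∈-upTo⁺ 0<B) (0∈ Λ))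
  ... | inj₁ B≤a rewrite +-identityʳ a = conductor≤⇒∈ Λ (≤-trans c≤B B≤a)
  ... | inj₂ a∈xs rewrite +-identityʳ a = proj₂ (∈-filter⁻ (carrier? Λ) {xs = upTo B} a∈xs)

-- The threshold `suc B` is positive, as `≈-stabilizer` demands. Repetitions and semigroups of
-- conductor B + 1 may occur, which is harmless in a list of exceptions.
semigroups-with-conductor≤ : ℕ → List NumericalSemigroup
semigroups-with-conductor≤ B = map (stabilizer (suc B)) (sublists (upTo (suc B)))

conductor≤⇒listed : ∀ Λ {B} → conductor Λ ≤ B → Any (Λ ≈_) (semigroups-with-conductor≤ B)
conductor≤⇒listed Λ {B} c≤B = Any.map⁺
  (lose (filter∈sublists (carrier? Λ) (upTo (suc B))) (≈-stabilizer Λ z<s (m≤n⇒m≤1+n c≤B)))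

-- Small conductor or large ratio.

-- The cases are c < T m, where m is bounded by `multiplicity≤`, and T m ≤ c, where the error term k
-- T m in T times `conductor≤` is at most k c.
conductor-dichotomy : ∀ Λ {k} → HasEmbeddingDimension Λ k → ∀ T →
  conductor Λ ≤ T * suc T ^ k ⊎ T * conductor Λ ≤ k * (T * c′ Λ) + k * conductor Λ
conductor-dichotomy Λ (gs , _ , refl , gs-generate , _) T with least-positive gs
-- Zeros generate only 0, but the positive number c + 1 lies in Λ.
... | inj₁ zeros = contradiction
  (combination-zeros zeros (⟨⟩⇒combination (proj₂ gs-generate
    (conductor≤⇒∈ Λ (n≤1+n (conductor Λ)))))) λ ()
... | inj₂ (m , m∈gs , 0<m , m≤gs) with T * m ≤? conductor Λ
...   | no Tm≰c = inj₁ (≤-trans (<⇒≤ (≰⇒> Tm≰c))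
    (*-monoʳ-≤ T (multiplicity≤ gs-generate T m≤gs (≰⇒> Tm≰c))))
  where open Apéry Λ m (proj₁ gs-generate (gen m∈gs))
...   | yes Tm≤c = inj₂ (begin
  T * c                        ≤⟨ *-monoʳ-≤ T (conductor≤ gs-generate m∈gs 0<m) ⟩
  T * (k * (c′ Λ + m))         ≡⟨ lemma T k (c′ Λ) m ⟩
  k * (T * c′ Λ) + k * (T * m) ≤⟨ +-monoʳ-≤ (k * (T * c′ Λ)) (*-monoʳ-≤ k Tm≤c) ⟩
  k * (T * c′ Λ) + k * c       ∎)
  where
  open Apéry Λ m (proj₁ gs-generate (gen m∈gs))
  open ≤-Reasoning
  k : ℕ
  k = length gs
  lemma : ∀ T k x m → T * (k * (x + m)) ≡ k * (T * x) + k * (T * m)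
  lemma = solve-∀

-- Passage to rational and real inequalities.

open import Data.Integer.Base using (+_)
import Data.Integer.Base as ℤ
import Data.Integer.Properties as ℤ
open import Data.Rational.Base as ℚ using (_/_; 0ℚ; ½; toℚᵘ; mkℚ)
import Data.Rational.Properties as ℚ
open import Data.Rational.Solver using (module +-*-Solver)
open import Data.Rational.Unnormalised.Base as ℚᵘ using (mkℚᵘ)
import Data.Rational.Unnormalised.Properties as ℚᵘ

-- Division of the hypothesis by k c T, carried out as cross-multiplication of unnormalised
-- fractions.
1/k≤x/c+1/T : ∀ k x c T .{{_ : NonZero k}} .{{_ : NonZero c}} .{{_ : NonZero T}} →
  T * c ≤ k * (T * x) + k * c → + 1 / k ℚ.≤ + x / c ℚ.+ + 1 / T
1/k≤x/c+1/T k@(suc k-1) x c@(suc c-1) T@(suc T-1) h = ℚ.toℚᵘ-cancel-≤ (begin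
  toℚᵘ (+ 1 / k)                       ≃⟨ ℚ.toℚᵘ-fromℚᵘ (mkℚᵘ (+ 1) k-1) ⟩
  mkℚᵘ (+ 1) k-1                       ≤⟨ ℚᵘ.*≤* numerators ⟩
  mkℚᵘ (+ x) c-1 ℚᵘ.+ mkℚᵘ (+ 1) T-1   ≃⟨ ℚᵘ.+-cong (ℚ.toℚᵘ-fromℚᵘ (mkℚᵘ (+ x) c-1))
                                                     (ℚ.toℚᵘ-fromℚᵘ (mkℚᵘ (+ 1) T-1)) ⟨
  toℚᵘ (+ x / c) ℚᵘ.+ toℚᵘ (+ 1 / T)   ≃⟨ ℚ.toℚᵘ-homo-+ (+ x / c) (+ 1 / T) ⟨
  toℚᵘ (+ x / c ℚ.+ + 1 / T)           ∎)
  where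
  open ℚᵘ.≤-Reasoning
  lemma : ∀ k x c T → k * (T * x) + k * c ≡ (x * T + 1 * c) * k
  lemma = solve-∀
  numeratorsℕ : 1 * (c * T) ≤ (x * T + 1 * c) * k
  numeratorsℕ = subst₂ _≤_ (trans (*-comm T c) (sym (*-identityˡ (c * T)))) (lemma k x c T) h
  numerators : + 1 ℤ.* + (c * T) ℤ.≤ (+ x ℤ.* + T ℤ.+ + 1 ℤ.* + c) ℤ.* + k
  numerators rewrite sym (ℤ.pos-* x T) | sym (ℤ.pos-* 1 c) | sym (ℤ.pos-* (x * T + 1 * c) k)
    | sym (ℤ.pos-* 1 (c * T)) = ℤ.+≤+ numeratorsℕ

-- T is the denominator of q, whose numerator is at least 1.
positive⇒≥1/T : ∀ q → 0ℚ ℚ.< q → Σ[ T ∈ ℕ ] Σ[ T≢0 ∈ NonZero T ] (_/_ (+ 1) T {{T≢0}} ℚ.≤ q)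
positive⇒≥1/T q@(mkℚ ℤ.+[1+ n ] T-1 _) _ = suc T-1 , _ , ℚ.toℚᵘ-cancel-≤ (begin
  toℚᵘ (+ 1 / suc T-1)   ≃⟨ ℚ.toℚᵘ-fromℚᵘ (mkℚᵘ (+ 1) T-1) ⟩
  mkℚᵘ (+ 1) T-1         ≤⟨ ℚᵘ.*≤* (ℤ.*-monoʳ-≤-nonNeg (+ suc T-1) (ℤ.+≤+ (s≤s (z≤n {n})))) ⟩
  toℚᵘ q                 ∎)
  where open ℚᵘ.≤-Reasoning
positive⇒≥1/T (mkℚ (+ 0)      _ _) (ℚ.*<* (ℤ.+<+ ()))
positive⇒≥1/T (mkℚ ℤ.-[1+ _ ] _ _) (ℚ.*<* ())

-- One half of the gap δ pays for the error u; the other half remains as the gap that `_<ℝ_`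
-- requires.
p-e+½δ≤r : ∀ {p u r e} δ → p ℚ.≤ r ℚ.+ u → u ℚ.≤ ½ ℚ.* δ → 0ℚ ℚ.+ δ ℚ.≤ e →
  (p ℚ.- e) ℚ.+ ½ ℚ.* δ ℚ.≤ r
p-e+½δ≤r {p} {u} {r} {e} δ p≤r+u u≤½δ δ≤e = begin
  (p ℚ.- e) ℚ.+ ½ ℚ.* δ
    ≤⟨ ℚ.+-monoˡ-≤ (½ ℚ.* δ) (ℚ.+-mono-≤
         (ℚ.≤-trans p≤r+u (ℚ.+-monoʳ-≤ r u≤½δ)) (ℚ.neg-antimono-≤ δ≤e)) ⟩
  ((r ℚ.+ ½ ℚ.* δ) ℚ.- (0ℚ ℚ.+ δ)) ℚ.+ ½ ℚ.* δ
    ≡⟨ solve 2 (λ r δ → ((r :+ con ½ :* δ) :+ (:- (con 0ℚ :+ δ))) :+ con ½ :* δ := r)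
         refl r δ ⟩
  r ∎
  where
  open ℚ.≤-Reasoning
  open +-*-Solver

ratio-bound : ∀ Λ {k T} → HasEmbeddingDimension Λ k → T * suc T ^ k < conductor Λ →
  .{{_ : NonZero k}} .{{_ : NonZero T}} .{{_ : NonZero (conductor Λ)}} →
  + 1 / k ℚ.≤ + c′ Λ / conductor Λ ℚ.+ + 1 / T
ratio-bound Λ {k} {T} e≡k B<c = 1/k≤x/c+1/T k (c′ Λ) (conductor Λ) T
  (Sum.fromInj₂ (λ c≤B → contradiction (≤-<-trans c≤B B<c) (<-irrefl refl))
    (conductor-dichotomy Λ e≡k T))

½*-pos : ∀ {δ} → 0ℚ ℚ.< δ → 0ℚ ℚ.< ½ ℚ.* δ
½*-pos {δ} 0<δ = subst (ℚ._< ½ ℚ.* δ) (ℚ.*-zeroʳ ½) (ℚ.*-monoʳ-<-pos ½ 0<δ)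

theorem2 : (k : ℕ) .{{_ : NonZero k}} (ε : ℝ) → 0ℝ <ℝ ε →
    Σ[ exceptions ∈ List NumericalSemigroup ]
    (∀ Λ → HasEmbeddingDimension Λ k → ¬ Any (Λ ≈_) exceptions →
    Σ[ c>0 ∈ conductor Λ > 0 ]
    fromℚ (+ 1 / k) -ℝ ε
    <ℝ fromℚ (_/_ (+ c′ Λ) (conductor Λ) {{>-nonZero c>0}}))
theorem2 k {{k≢0}} ε (δ , 0<δ , M , δ≤ε) = case positive⇒≥1/T (½ ℚ.* δ) (½*-pos 0<δ) of λ where
  -- The bound is the first alternative of the dichotomy, so an unlisted semigroup has positive
  -- conductor and falls under the second.
  (T , T≢0 , 1/T≤½δ) → semigroups-with-conductor≤ (T * suc T ^ k) , λ Λ e≡k unlisted →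
    let B<c = ≰⇒> (unlisted ∘ conductor≤⇒listed Λ)
        c>0 = ≤-<-trans z≤n B<c
    in  c>0 , ½ ℚ.* δ , ½*-pos 0<δ , M , λ n M≤n →
          p-e+½δ≤r δ (ratio-bound Λ e≡k B<c {{k≢0}} {{T≢0}} {{>-nonZero c>0}})
            1/T≤½δ (δ≤ε n M≤n)
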